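{- Let $s$ be a formula of the monomodal language $\mathit{ML}$. 1. If $\models^{K} s$, then $\models^{STT} |\mathtt{Mval}\ s|$. 2. If $\models^{S4} s$, then $\{\mathtt{R},\mathtt{T}\}\models^{STT} |\mathtt{Mval}\ s|$. Here $\mathtt{R}$ is the formula $\forall X_{\iota\to o}.\,|\mathtt{Mval}\ (\Box_r X\supset X)|$ and $\mathtt{T}$ is the formula $\forall X_{\iota\to o}.\,|\mathtt{Mval}\ (\Box_r X\supset \Box_r\Box_r X)|$ of simple type theory.
   Context: **Modal logic.** Formulas of $\mathit{ML}$ are given by $s,t ::= p \mid \neg s \mid s\vee t\mid \Box_r s$, where $p$ ranges over atomic primitives $p^1,\dots,p^m$ ($m\ge 1$) and $r$ is a single fixed relation symbol (monomodal case). Other connectives are defined as usual. A Kripke frame is a pair $\langle W,(R_r)\rangle$ with $W$ a non-empty set and $R_r$ a binary relation on $W$. A Kripke model is $\langle W,(R_r),\models\rangle$ with $\models$ a relation between elements of $W$ and formulas such that: $w\models\neg s$ iff $w\not\models s$; $w\models s\vee t$ iff $w\models s$ or $w\models t$; $w\models\Box_r s$ iff $u\models s$ for all $u$ with $R_r(w,u)$ (so $\models$ is determined by its values on atomic primitives). $\models^K s$ means $w\models s$ for all worlds $w$ of all Kripke models; $\models^{S4}s$ means the same for all Kripke models whose relation $R_r$ is reflexive and transitive. **Simple type theory (STT).** Types are freely generated from base types $o$ (Booleans) and $\iota$ by $\to$. Terms are simply typed $\lambda$-terms built from typed variables, typed constants and the logical constants $\neg_{o\to o}$, $\vee_{o\to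 o\to o}$, $\Pi_{(\alpha\to o)\to o}$ (each type $\alpha$); $\forall X_\alpha.\,s$ abbreviates $\Pi(\lambda X_\alpha.\,s)$, and $\wedge,\Rightarrow$ are defined as usual. The non-logical constants are $p^j_{\iota\to o}$, one for each atomic primitive $p^j$, and $r_{\iota\to\iota\to o}$. A frame is a family $\{D_\alpha\}$ of non-empty sets with $D_o=\{T,F\}$ and $D_{\alpha\to\beta}$ a set of functions from $D_\alpha$ to $D_\beta$. An interpretation $\langle\{D_\alpha\},I\rangle$ additionally assigns to each constant $c_\alpha$ an element $I c_\alpha\in D_\alpha$, with $\neg,\vee,\Pi$ interpreted as negation, disjunction and universal quantification over $D_\alpha$. It is a Henkin model if there is a (then unique) evaluation function $\mathcal V$ such that, for every variable assignment $\phi$, $\mathcal V_\phi s_\alpha\in D_\alpha$ for every term $s_\alpha$, $\mathcal V_\phi X=\phi X$, $\mathcal V_\phi c=Ic$, $\mathcal V_\phi(s\,t)=(\mathcal V_\phi s)(\mathcal V_\phi t)$, and $\mathcal V_\phi(\lambda X_\alpha.\,s_\beta)$ is the function $z\mapsto \mathcal V_{[z/X_\alpha],\phi}s_\beta$, where $[z/X_\alpha],\phi$ is $\phi$ modified to map $X_\alpha$ to $z$. A formula (term of type $o$) $A$ is valid in a Henkin model if $\mathcal V_\phi A=T$ for all $\phi$. $\models^{STT}A$ means $A$ is valid in all Henkin models; $\Gamma\models^{STT}A$ means $A$ is valid in every Henkin model in which all formulas of $\Gamma$ are valid. **Embedding.** Put $|p|=p_{\iota\to o}$, $|r|=r_{\iota\to\iota\to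 o}$, $|\neg|=\lambda A_{\iota\to o}.\lambda X_\iota.\,\neg(A\,X)$, $|\vee|=\lambda A_{\iota\to o}.\lambda B_{\iota\to o}.\lambda X_\iota.\,(A\,X)\vee(B\,X)$, $|\supset|=\lambda A_{\iota\to o}.\lambda B_{\iota\to o}.\lambda X_\iota.\,(A\,X)\Rightarrow(B\,X)$, $|\Box|=\lambda R_{\iota\to\iota\to o}.\lambda A_{\iota\to o}.\lambda X_\iota.\,\forall Y_\iota.\,(R\,X\,Y)\Rightarrow(A\,Y)$, and $|\mathtt{Mval}|=\lambda A_{\iota\to o}.\,\forall W_\iota.\,A\,W$. A compound expression is translated by applying the translated connective to the translated arguments: $|\neg s|=|\neg|\,|s|$, $|s\vee t|=|\vee|\,|s|\,|t|$, $|s\supset t|=|\supset|\,|s|\,|t|$, $|\Box_r s|=|\Box|\,|r|\,|s|$, $|\mathtt{Mval}\ s|=|\mathtt{Mval}|\,|s|$; a variable $X_{\iota\to o}$ of STT occurring in such an expression is translated to itself. -}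

module Defs where

open import Data.Bool.Base using (Bool; true; not; _∨_)
open import Data.Fin.Base using (Fin)
open import Data.Nat.Base using (ℕ)
import Data.Nat.Properties as ℕ
open import Data.Sum.Base using (_⊎_)
open import Function.Bundles using (_⇔_)
open import Level using (0ℓ)
open import Relation.Binary.Core using (Rel)
open import Relation.Binary.Definitions using (DecidableEquality; Reflexive; Transitive)
open import Relation.Binary.PropositionalEquality using (_≡_; refl)
open import Relation.Nullary using (¬_; Dec; yes; no)
open import Relation.Unary using (Pred; _∈_)

data ML (m : ℕ) : Set where
  atom : Fin m → ML m
  neg  : ML m → ML m
  _or_ : ML m → ML m → ML m
  □_   : ML m → ML m

record KripkeFrame : Set₁ where
  field
    W        : Set
    nonempty : W
    R        : Rel W 0ℓ

-- The forcing relation is required to be decidable: this is the classical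
-- (two-valued) reading of "relation".  Without it, p ∨ ¬ p would not be
-- provably K-valid in Agda's constructive metatheory.
record KripkeModel (m : ℕ) : Set₁ where
  infix 4 _⊨_
  field
    frame : KripkeFrame
  open KripkeFrame frame public
  field
    _⊨_    : W → ML m → Set
    _⊨?_   : ∀ w s → Dec (w ⊨ s)
    ⊨-neg  : ∀ {w s} → w ⊨ neg s ⇔ (¬ (w ⊨ s))
    ⊨-or   : ∀ {w s t} → w ⊨ (s or t) ⇔ (w ⊨ s ⊎ w ⊨ t)
    ⊨-□    : ∀ {w s} → w ⊨ (□ s) ⇔ (∀ u → R w u → u ⊨ s)

infix 4 ⊨ᴷ_ ⊨ˢ⁴_

⊨ᴷ_ : ∀ {m} → ML m → Set₁
⊨ᴷ_ {m} s = (M : KripkeModel m) → let open KripkeModel M in ∀ w → w ⊨ s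

⊨ˢ⁴_ : ∀ {m} → ML m → Set₁
⊨ˢ⁴_ {m} s = (M : KripkeModel m) → let open KripkeModel M in
             Reflexive R → Transitive R → ∀ w → w ⊨ s

infixr 7 _⇒_

data Ty : Set where
  o ι : Ty
  _⇒_ : Ty → Ty → Ty

_≟ᵀ_ : DecidableEquality Ty
o ≟ᵀ o = yes refl
o ≟ᵀ ι = no λ ()
o ≟ᵀ (_ ⇒ _) = no λ ()
ι ≟ᵀ o = no λ ()
ι ≟ᵀ ι = yes refl
ι ≟ᵀ (_ ⇒ _) = no λ ()
(_ ⇒ _) ≟ᵀ o = no λ ()
(_ ⇒ _) ≟ᵀ ι = no λ ()
(α ⇒ β) ≟ᵀ (γ ⇒ δ) with α ≟ᵀ γ | β ≟ᵀ δ
... | yes refl | yes refl = yes refl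
... | no α≢γ   | _        = no λ { refl → α≢γ refl }
... | yes _    | no β≢δ   = no λ { refl → β≢δ refl }

data Con (m : ℕ) : Ty → Set where
  ¬ᶜ : Con m (o ⇒ o)
  ∨ᶜ : Con m (o ⇒ o ⇒ o)
  Πᶜ : ∀ α → Con m ((α ⇒ o) ⇒ o)
  pᶜ : Fin m → Con m (ι ⇒ o)
  rᶜ : Con m (ι ⇒ ι ⇒ o)

-- A variable is a name together with its type; variables with the same name
-- but different types are distinct.
Name : Set
Name = ℕ

infixl 20 _·_

data Term (m : ℕ) : Ty → Set where
  var : (x : Name) (α : Ty) → Term m α
  con : ∀ {α} → Con m α → Term m α
  _·_ : ∀ {α β} → Term m (α ⇒ β) → Term m α → Term m β
  lam : (x : Name) (α : Ty) → ∀ {β} → Term m β → Term m (α ⇒ β)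

Formula : ℕ → Set
Formula m = Term m o

¬ᵒ_ : ∀ {m} → Formula m → Formula m
¬ᵒ s = con ¬ᶜ · s

_∨ᵒ_ : ∀ {m} → Formula m → Formula m → Formula m
s ∨ᵒ t = con ∨ᶜ · s · t

_⇒ᵒ_ : ∀ {m} → Formula m → Formula m → Formula m
s ⇒ᵒ t = (¬ᵒ s) ∨ᵒ t

∀ᵒ : ∀ {m} (x : Name) (α : Ty) → Formula m → Formula m
∀ᵒ x α s = con (Πᶜ α) · lam x α s

Domain : Set → (Ty → Ty → Set) → Ty → Set
Domain Ind Fun o       = Bool
Domain Ind Fun ι       = Ind
Domain Ind Fun (α ⇒ β) = Fun α β

-- D (α ⇒ β) is a set of functions from D α to D β: an element f is
-- identified with the function app f, since by ext the map app is injective.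
record Frame : Set₁ where
  field
    Individuals : Set
    Functions   : Ty → Ty → Set

  D : Ty → Set
  D = Domain Individuals Functions

  field
    nonempty : ∀ α → D α
    app      : ∀ {α β} → D (α ⇒ β) → D α → D β
    ext      : ∀ {α β} {f g : D (α ⇒ β)} → (∀ z → app f z ≡ app g z) → f ≡ g

  Assignment : Set
  Assignment = Name → (α : Ty) → D α

  _[_,_]≔_ : Assignment → Name → (α : Ty) → D α → Assignment
  (φ [ x , α ]≔ z) y β with x ℕ.≟ y | α ≟ᵀ β
  ... | yes _ | yes refl = z
  ... | yes _ | no _     = φ y β
  ... | no _  | _        = φ y β

record Interpretation (m : ℕ) : Set₁ where
  field
    frame : Frame
  open Frame frame public
  field
    I   : ∀ {α} → Con m α → D α
    I-¬ : ∀ a → app (I ¬ᶜ) a ≡ not a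
    I-∨ : ∀ a b → app (app (I ∨ᶜ) a) b ≡ a ∨ b
    I-Π : ∀ {α} (f : D (α ⇒ o)) → app (I (Πᶜ α)) f ≡ true ⇔ (∀ z → app f z ≡ true)

record HenkinModel (m : ℕ) : Set₁ where
  field
    interpretation : Interpretation m
  open Interpretation interpretation public
  field
    V     : Assignment → ∀ {α} → Term m α → D α
    V-var : ∀ φ x α → V φ (var x α) ≡ φ x α
    V-con : ∀ φ {α} (c : Con m α) → V φ (con c) ≡ I c
    V-app : ∀ φ {α β} (s : Term m (α ⇒ β)) (t : Term m α) →
            V φ (s · t) ≡ app (V φ s) (V φ t)
    V-lam : ∀ φ x α {β} (s : Term m β) (z : D α) →
            app (V φ (lam x α s)) z ≡ V (φ [ x , α ]≔ z) s

  Valid : Formula m → Set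
  Valid A = ∀ φ → V φ A ≡ true

infix 4 ⊨ˢᵀᵀ_ _⊨ˢᵀᵀ_

⊨ˢᵀᵀ_ : ∀ {m} → Formula m → Set₁
⊨ˢᵀᵀ_ {m} A = (H : HenkinModel m) → HenkinModel.Valid H A

_⊨ˢᵀᵀ_ : ∀ {m} → Pred (Formula m) 0ℓ → Formula m → Set₁
_⊨ˢᵀᵀ_ {m} Γ A = (H : HenkinModel m) → let open HenkinModel H in
                 (∀ B → B ∈ Γ → Valid B) → Valid A

module _ {m : ℕ} where

  private
    nX nY nA nB nR nW : Name
    nX = 0
    nY = 1
    nA = 2
    nB = 3
    nR = 4
    nW = 5

    X Y W : Term m ι
    X = var nX ι
    Y = var nY ι
    W = var nW ι

    A B : Term m (ι ⇒ o)
    A = var nA (ι ⇒ o)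
    B = var nB (ι ⇒ o)

    R : Term m (ι ⇒ ι ⇒ o)
    R = var nR (ι ⇒ ι ⇒ o)

    Xₚ : Term m (ι ⇒ o)
    Xₚ = var nX (ι ⇒ o)

  ∣r∣ : Term m (ι ⇒ ι ⇒ o)
  ∣r∣ = con rᶜ

  ∣¬∣ : Term m ((ι ⇒ o) ⇒ ι ⇒ o)
  ∣¬∣ = lam nA (ι ⇒ o) (lam nX ι (¬ᵒ (A · X)))

  ∣∨∣ : Term m ((ι ⇒ o) ⇒ (ι ⇒ o) ⇒ ι ⇒ o)
  ∣∨∣ = lam nA (ι ⇒ o) (lam nB (ι ⇒ o) (lam nX ι ((A · X) ∨ᵒ (B · X))))

  ∣⊃∣ : Term m ((ι ⇒ o) ⇒ (ι ⇒ o) ⇒ ι ⇒ o)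
  ∣⊃∣ = lam nA (ι ⇒ o) (lam nB (ι ⇒ o) (lam nX ι ((A · X) ⇒ᵒ (B · X))))

  ∣□∣ : Term m ((ι ⇒ ι ⇒ o) ⇒ (ι ⇒ o) ⇒ ι ⇒ o)
  ∣□∣ = lam nR (ι ⇒ ι ⇒ o) (lam nA (ι ⇒ o) (lam nX ι
          (∀ᵒ nY ι ((R · X · Y) ⇒ᵒ (A · Y)))))

  ∣Mval∣ : Term m ((ι ⇒ o) ⇒ o)
  ∣Mval∣ = lam nA (ι ⇒ o) (∀ᵒ nW ι (A · W))

  ∣_∣ : ML m → Term m (ι ⇒ o)
  ∣ atom j ∣ = con (pᶜ j)
  ∣ neg s ∣  = ∣¬∣ · ∣ s ∣
  ∣ s or t ∣ = ∣∨∣ · ∣ s ∣ · ∣ t ∣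
  ∣ □ s ∣    = ∣□∣ · ∣r∣ · ∣ s ∣

  𝐑 : Formula m
  𝐑 = ∀ᵒ nX (ι ⇒ o) (∣Mval∣ · (∣⊃∣ · (∣□∣ · ∣r∣ · Xₚ) · Xₚ))

  𝐓 : Formula m
  𝐓 = ∀ᵒ nX (ι ⇒ o) (∣Mval∣ · (∣⊃∣ · (∣□∣ · ∣r∣ · Xₚ) · (∣□∣ · ∣r∣ · (∣□∣ · ∣r∣ · Xₚ))))

{-# OPTIONS --safe #-}
module Submission where

-- The worlds of a Kripke model can be read off a Henkin model: they are the
-- individuals, and w forces s when ∣ s ∣ holds of w.  In such a model, axiom 𝐑
-- or 𝐓 instantiated at X := r w makes the accessibility relation reflexive,
-- respectively transitive, since w always forces □ (r w).

open import Defs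
open import Data.Bool.Base using (true; false; not; _∨_)
import Data.Bool.Properties as Bool
open import Data.Nat.Base using (ℕ; _≥_)
open import Data.Product.Base using (_×_; _,_)
open import Data.Sum.Base using (_⊎_; inj₁; inj₂)
open import Function.Bundles using (_⇔_; mk⇔; module Equivalence)
open import Function.Construct.Composition using (_⇔-∘_)
open import Relation.Binary.Definitions using (Reflexive; Transitive)
open import Relation.Binary.PropositionalEquality
  using (_≡_; refl; sym; trans; cong; cong₂; module ≡-Reasoning)
open import Relation.Nullary using (¬_; contradiction)
open import Relation.Unary using (｛_｝; _∪_)

open Equivalence using (to; from)

≡⇒≡true⇔ : ∀ {a b} → a ≡ b → a ≡ true ⇔ b ≡ true
≡⇒≡true⇔ refl = mk⇔ (λ p → p) (λ p → p)

not-true⇔ : ∀ a → not a ≡ true ⇔ (¬ a ≡ true)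
not-true⇔ true  = mk⇔ (λ ()) (λ ¬p → contradiction refl ¬p)
not-true⇔ false = mk⇔ (λ _ ()) (λ _ → refl)

∨-true⇔ : ∀ a b → a ∨ b ≡ true ⇔ (a ≡ true ⊎ b ≡ true)
∨-true⇔ true  b = mk⇔ inj₁ (λ _ → refl)
∨-true⇔ false b = mk⇔ inj₂ λ { (inj₁ ()) ; (inj₂ p) → p }

⇒-true⇔ : ∀ a b → not a ∨ b ≡ true ⇔ (a ≡ true → b ≡ true)
⇒-true⇔ true  b = mk⇔ (λ p _ → p) (λ f → f refl)
⇒-true⇔ false b = mk⇔ (λ _ ()) (λ _ → refl)

module _ {m : ℕ} (H : HenkinModel m) where
  open HenkinModel H
  open ≡-Reasoning

  V-¬ᵒ : ∀ φ (A : Formula m) → V φ (¬ᵒ A) ≡ not (V φ A)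
  V-¬ᵒ φ A = begin
    V φ (¬ᵒ A)                   ≡⟨ V-app φ _ A ⟩
    app (V φ (con ¬ᶜ)) (V φ A)   ≡⟨ cong (λ f → app f (V φ A)) (V-con φ ¬ᶜ) ⟩
    app (I ¬ᶜ) (V φ A)           ≡⟨ I-¬ _ ⟩
    not (V φ A)                  ∎

  V-∨ᵒ : ∀ φ (A B : Formula m) → V φ (A ∨ᵒ B) ≡ V φ A ∨ V φ B
  V-∨ᵒ φ A B = begin
    V φ (A ∨ᵒ B)                             ≡⟨ V-app φ _ B ⟩
    app (V φ (con ∨ᶜ · A)) (V φ B)           ≡⟨ cong (λ f → app f (V φ B)) (V-app φ _ A) ⟩
    app (app (V φ (con ∨ᶜ)) (V φ A)) (V φ B) ≡⟨ cong (λ f → app (app f (V φ A)) (V φ B)) (V-con φ ∨ᶜ) ⟩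
    app (app (I ∨ᶜ) (V φ A)) (V φ B)         ≡⟨ I-∨ _ _ ⟩
    V φ A ∨ V φ B                            ∎

  V-⇒ᵒ : ∀ φ (A B : Formula m) → V φ (A ⇒ᵒ B) ≡ not (V φ A) ∨ V φ B
  V-⇒ᵒ φ A B = trans (V-∨ᵒ φ (¬ᵒ A) B) (cong (_∨ V φ B) (V-¬ᵒ φ A))

  -- An equivalence of truths instead of an equation in `Bool`, because `I-Π` only says when a
  -- quantification is `true`: over an arbitrary domain there is no Boolean operation to equate it
  -- with.
  V-∀ᵒ : ∀ φ x α (A : Formula m) →
         V φ (∀ᵒ x α A) ≡ true ⇔ (∀ z → V (φ [ x , α ]≔ z) A ≡ true)
  V-∀ᵒ φ x α A = mk⇔
    (λ p z → trans (sym (V-lam φ x α A z)) (to (I-Π _) (trans (sym V-Π) p) z))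
    (λ p → trans V-Π (from (I-Π _) (λ z → trans (V-lam φ x α A z) (p z))))
    where
    V-Π : V φ (∀ᵒ x α A) ≡ app (I (Πᶜ α)) (V φ (lam x α A))
    V-Π = trans (V-app φ _ _) (cong (λ f → app f _) (V-con φ (Πᶜ α)))

  -- Beta reduction done semantically: the value of the argument enters the assignment, so no
  -- syntactic substitution, and hence no variable capture, ever arises.
  V-β : ∀ φ x {α β} (s : Term m β) (t : Term m α) →
        V φ (lam x α s · t) ≡ V (φ [ x , α ]≔ V φ t) s
  V-β φ x s t = trans (V-app φ _ t) (V-lam φ x _ s _)

  V-β-app : ∀ φ x y {α β γ} (s : Term m γ) (t : Term m α) z →
            app (V φ (lam x α (lam y β s) · t)) z ≡
            V ((φ [ x , α ]≔ V φ t) [ y , β ]≔ z) s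
  V-β-app φ x y s t z =
    trans (cong (λ f → app f z) (V-β φ x (lam y _ s) t)) (V-lam _ y _ s z)

  V-β₂-app : ∀ φ x y z {α β γ δ} (s : Term m δ) (t : Term m α) (u : Term m β) d →
             app (V φ (lam x α (lam y β (lam z γ s)) · t · u)) d ≡
             V (((φ [ x , α ]≔ V φ t) [ y , β ]≔ V φ u) [ z , γ ]≔ d) s
  V-β₂-app φ x y z s t u d = trans
    (cong (λ f → app f d)
      (trans (V-app φ _ u) (V-β-app φ x y (lam z _ s) t (V φ u))))
    (V-lam _ z _ s d)

  -- Serves the bodies of the translated connectives. There names and types are concrete, so the
  -- lookups on the right compute to the values bound by the enclosing lambdas.
  V-var-app : ∀ φ x y α β → V φ (var x (α ⇒ β) · var y α) ≡ app (φ x (α ⇒ β)) (φ y α)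
  V-var-app φ x y α β = trans (V-app φ _ _) (cong₂ app (V-var φ x _) (V-var φ y _))

  V-var-app₂ : ∀ φ x y z α β γ →
               V φ (var x (α ⇒ β ⇒ γ) · var y α · var z β) ≡
               app (app (φ x (α ⇒ β ⇒ γ)) (φ y α)) (φ z β)
  V-var-app₂ φ x y z α β γ =
    trans (V-app φ _ _) (cong₂ app (V-var-app φ x y α (β ⇒ γ)) (V-var φ z _))

  _⟶_ : D ι → D ι → Set
  w ⟶ u = app (app (I rᶜ) w) u ≡ true

  -- Defined for arbitrary predicate terms, so that the connective lemmas cover both translated
  -- formulas and the variable `X` of `𝐑` and `𝐓`.
  ⟨_⟩_∈_ : Assignment → D ι → Term m (ι ⇒ o) → Set
  ⟨ φ ⟩ w ∈ s = app (V φ s) w ≡ true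

  -- Numerals are names of bound variables: in the translated connectives
  -- 0 … 5 stand for X, Y, A, B, R, W.
  ∈-∣¬∣ : ∀ φ w s → ⟨ φ ⟩ w ∈ (∣¬∣ · s) ⇔ (¬ ⟨ φ ⟩ w ∈ s)
  ∈-∣¬∣ φ w s = not-true⇔ _ ⇔-∘ ≡⇒≡true⇔ (begin
    app (V φ (∣¬∣ · s)) w  ≡⟨ V-β-app φ 2 0 _ s w ⟩
    _                      ≡⟨ V-¬ᵒ _ _ ⟩
    _                      ≡⟨ cong not (V-var-app _ 2 0 ι o) ⟩
    not (app (V φ s) w)    ∎)

  ∈-∣∨∣ : ∀ φ w s t → ⟨ φ ⟩ w ∈ (∣∨∣ · s · t) ⇔ (⟨ φ ⟩ w ∈ s ⊎ ⟨ φ ⟩ w ∈ t)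
  ∈-∣∨∣ φ w s t = ∨-true⇔ _ _ ⇔-∘ ≡⇒≡true⇔ (begin
    app (V φ (∣∨∣ · s · t)) w      ≡⟨ V-β₂-app φ 2 3 0 _ s t w ⟩
    _                              ≡⟨ V-∨ᵒ _ _ _ ⟩
    _                              ≡⟨ cong₂ _∨_ (V-var-app _ 2 0 ι o) (V-var-app _ 3 0 ι o) ⟩
    app (V φ s) w ∨ app (V φ t) w  ∎)

  ∈-∣⊃∣ : ∀ φ w s t → ⟨ φ ⟩ w ∈ (∣⊃∣ · s · t) ⇔ (⟨ φ ⟩ w ∈ s → ⟨ φ ⟩ w ∈ t)
  ∈-∣⊃∣ φ w s t = ⇒-true⇔ _ _ ⇔-∘ ≡⇒≡true⇔ (begin
    app (V φ (∣⊃∣ · s · t)) w            ≡⟨ V-β₂-app φ 2 3 0 _ s t w ⟩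
    _                                    ≡⟨ V-⇒ᵒ _ _ _ ⟩
    _                                    ≡⟨ cong₂ (λ a b → not a ∨ b) (V-var-app _ 2 0 ι o) (V-var-app _ 3 0 ι o) ⟩
    not (app (V φ s) w) ∨ app (V φ t) w  ∎)

  -- The quantifier inside the box blocks a single chain of Boolean equations: the part outside it
  -- and the body below it are computed separately and joined through `V-∀ᵒ`.
  ∈-∣□∣ : ∀ φ w s → ⟨ φ ⟩ w ∈ (∣□∣ · ∣r∣ · s) ⇔ (∀ u → w ⟶ u → ⟨ φ ⟩ u ∈ s)
  ∈-∣□∣ φ w s = mk⇔
    (λ p u → to (⇒-true⇔ _ _)
      (trans (sym (V-body u)) (to (V-∀ᵒ φ′ 1 ι _) (trans (sym V-□) p) u)))
    (λ p → trans V-□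
      (from (V-∀ᵒ φ′ 1 ι _) (λ u → trans (V-body u) (from (⇒-true⇔ _ _) (p u)))))
    where
    φ′ : Assignment
    φ′ = ((φ [ 4 , ι ⇒ ι ⇒ o ]≔ V φ ∣r∣) [ 2 , ι ⇒ o ]≔ V φ s) [ 0 , ι ]≔ w

    V-□ = V-β₂-app φ 4 2 0 _ ∣r∣ s w

    body : Formula m
    body = (var 4 (ι ⇒ ι ⇒ o) · var 0 ι · var 1 ι) ⇒ᵒ (var 2 (ι ⇒ o) · var 1 ι)

    V-body : ∀ u → V (φ′ [ 1 , ι ]≔ u) body ≡
                   not (app (app (I rᶜ) w) u) ∨ app (V φ s) u
    V-body u = begin
      V (φ′ [ 1 , ι ]≔ u) body
        ≡⟨ V-⇒ᵒ _ _ _ ⟩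
      _
        ≡⟨ cong₂ (λ a b → not a ∨ b) (V-var-app₂ _ 4 0 1 ι ι o) (V-var-app _ 2 1 ι o) ⟩
      not (app (app (V φ ∣r∣) w) u) ∨ app (V φ s) u
        ≡⟨ cong (λ f → not (app (app f w) u) ∨ app (V φ s) u) (V-con φ rᶜ) ⟩
      not (app (app (I rᶜ) w) u) ∨ app (V φ s) u
        ∎

  V-∣Mval∣ : ∀ φ s → V φ (∣Mval∣ · s) ≡ true ⇔ (∀ w → ⟨ φ ⟩ w ∈ s)
  V-∣Mval∣ φ s = mk⇔
    (λ p w → trans (sym (V-var-app _ 2 5 ι o)) (to (V-∀ᵒ _ 5 ι _) (trans (sym (V-β φ 2 _ s)) p) w))
    (λ p → trans (V-β φ 2 _ s) (from (V-∀ᵒ _ 5 ι _) (λ w → trans (V-var-app _ 2 5 ι o) (p w))))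

  kripkeModel : Assignment → KripkeModel m
  kripkeModel φ = record
    { frame = record { W = D ι ; nonempty = nonempty ι ; R = _⟶_ }
    ; _⊨_   = λ w s → ⟨ φ ⟩ w ∈ ∣ s ∣
    -- Forcing is an equation in `Bool`, hence decidable.
    ; _⊨?_  = λ w s → app (V φ ∣ s ∣) w Bool.≟ true
    ; ⊨-neg = λ {w} {s} → ∈-∣¬∣ φ w ∣ s ∣
    ; ⊨-or  = λ {w} {s} {t} → ∈-∣∨∣ φ w ∣ s ∣ ∣ t ∣
    ; ⊨-□   = λ {w} {s} → ∈-∣□∣ φ w ∣ s ∣
    }

  ∈-var : ∀ φ w x → ⟨ φ ⟩ w ∈ var x (ι ⇒ o) ⇔ app (φ x (ι ⇒ o)) w ≡ true
  ∈-var φ w x = ≡⇒≡true⇔ (cong (λ f → app f w) (V-var φ x (ι ⇒ o)))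

  -- A Henkin domain may omit most sets of individuals, but the successor set of `w` is always
  -- present, as the value of `I rᶜ` at `w`. The claim then unfolds to `w ⟶ u → w ⟶ u`.
  ∈-□-successors : ∀ φ w → ⟨ φ [ 0 , ι ⇒ o ]≔ app (I rᶜ) w ⟩ w ∈ (∣□∣ · ∣r∣ · var 0 (ι ⇒ o))
  ∈-□-successors φ w = from (∈-∣□∣ _ w _) (λ u → from (∈-var _ u 0))

  𝐑⇒reflexive : Assignment → Valid 𝐑 → Reflexive _⟶_
  𝐑⇒reflexive φ valid {w} = to (∈-var _ w 0) (to (∈-∣⊃∣ _ w _ _) □X⊃X (∈-□-successors φ w))
    where □X⊃X = to (V-∣Mval∣ _ _) (to (V-∀ᵒ φ 0 (ι ⇒ o) _) (valid φ) (app (I rᶜ) w)) w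

  𝐓⇒transitive : Assignment → Valid 𝐓 → Transitive _⟶_
  𝐓⇒transitive φ valid {w} {u} {v} w⟶u u⟶v =
    -- Peel the two boxes along `w ⟶ u` and `u ⟶ v`; membership of `v` in the successor set of `w`
    -- is `w ⟶ v`.
    to (∈-var _ v 0) (to (∈-∣□∣ _ u _) (to (∈-∣□∣ _ w _) w∈□□X u w⟶u) v u⟶v)
    where
    □X⊃□□X = to (V-∣Mval∣ _ _) (to (V-∀ᵒ φ 0 (ι ⇒ o) _) (valid φ) (app (I rᶜ) w)) w
    w∈□□X  = to (∈-∣⊃∣ _ w _ _) □X⊃□□X (∈-□-successors φ w)

theorem3 : (m : ℕ) → m ≥ 1 → (s : ML m) →
    (⊨ᴷ s → ⊨ˢᵀᵀ (∣Mval∣ · ∣ s ∣)) ×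
    (⊨ˢ⁴ s → (｛ 𝐑 ｝ ∪ ｛ 𝐓 ｝) ⊨ˢᵀᵀ (∣Mval∣ · ∣ s ∣))
theorem3 m _ s =
  -- Forcing in `kripkeModel H φ` is by definition the membership that `V-∣Mval∣` asks for at every
  -- individual.
  (λ ⊨s H φ → from (V-∣Mval∣ H φ ∣ s ∣) (⊨s (kripkeModel H φ))) ,
  (λ ⊨s H ax φ → from (V-∣Mval∣ H φ ∣ s ∣)
    (⊨s (kripkeModel H φ)
      (𝐑⇒reflexive H φ (ax 𝐑 (inj₁ refl)))
      (𝐓⇒transitive H φ (ax 𝐓 (inj₂ refl)))))
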